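{- For every positive integer $k$, every parallel extension and every restriction of a $k$-system is a $k$-system. However, for $k\ge2$, the contraction of a $k$-system is not necessarily a $k$-system (i.e. for every integer $k\geq 2$ there exist a $k$-system $\mathcal{F}=(S,\mathcal{I})$ and $I\in\mathcal{I}$ such that $\mathcal{F}/I$ is not a $k$-system).
   Context: An independence system $(S,\mathcal{I})$ is a finite set $S$ with a nonempty downward-closed family $\mathcal{I}\subseteq2^S$ of independent sets. A loop is an element $s$ with $\{s\}\notin\mathcal{I}$. A basis of $X\subseteq S$ is an inclusion-wise maximal independent subset of $X$. $k$-system: for every $X\subseteq S$ and every two bases $P,Q$ of $X$, $|P|\le k|Q|$. Parallel extension of $\mathcal{F}=(S,\mathcal{I})$ along a non-loop element $s\in S$: ground set $S_{\circ s}=(S\setminus\{s\})\cup\{s_1,s_2\}$ with new elements $s_1,s_2$; for $X\subseteq S_{\circ s}$ let $\pi_s(X)=X$ if $X\cap\{s_1,s_2\}=\emptyset$ and $\pi_s(X)=(X\setminus\{s_1,s_2\})\cup\{s\}$ otherwise; the independent sets are the $X\subseteq S_{\circ s}$ with $|X\cap\{s_1,s_2\}|\le1$ and $\pi_s(X)\in\mathcal{I}$. Restriction to $Y\subseteq S$: $(Y,\{X\subseteq Y:X\in\mathcal{I}\})$. Contraction of $I\in\mathcal{I}$: $\mathcal{F}/I=(S\setminus I,\{X\subseteq S\setminus I:X\cup I\in\mathcal{I}\})$. -}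

module Defs where

open import Data.Bool using (true; false; if_then_else_; _∨_)
open import Data.Fin using (Fin; zero; suc)
open import Data.Fin.Subset
open import Data.Fin.Subset.Properties
open import Data.Nat using (ℕ; suc; _≤_; _*_; z≤n; _≤?_)
open import Data.Nat.Properties using (≤-trans; ≤-reflexive)
open import Data.Product using (∃; _×_; _,_; proj₁; proj₂)
open import Data.Sum using (inj₁; inj₂)
open import Data.Vec using (_∷_; here; there)
open import Relation.Binary.PropositionalEquality using (sym; trans; cong; subst)
open import Relation.Nullary using (¬_)
open import Relation.Nullary.Decidable using (_×-dec_)
open import Relation.Unary using (Decidable)

-- The ground set is a subset of an ambient Fin n, so that restriction and
-- contraction change the ground set but not the ambient type.  Decidability of
-- independence is automatic classically, as the family is a subset of 2^S.
record IndependenceSystem (n : ℕ) : Set₁ where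
  field
    ground       : Subset n
    Independent  : Subset n → Set
    independent? : Decidable Independent
    ⊆-ground     : ∀ {X} → Independent X → X ⊆ ground
    nonempty     : ∃ λ X → Independent X
    down-closed  : ∀ {X Y} → X ⊆ Y → Independent Y → Independent X

open IndependenceSystem public

private
  variable
    n : ℕ

Loop : IndependenceSystem n → Fin n → Set
Loop F s = s ∈ ground F × ¬ Independent F ⁅ s ⁆

IsBasis : IndependenceSystem n → Subset n → Subset n → Set
IsBasis F X B =
  Independent F B × B ⊆ X × (∀ C → Independent F C → C ⊆ X → ¬ (B ⊂ C))

IsKSystem : ℕ → IndependenceSystem n → Set
IsKSystem k F = ∀ X → X ⊆ ground F →
  ∀ P Q → IsBasis F X P → IsBasis F X Q → ∣ P ∣ ≤ k * ∣ Q ∣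

-- The new elements s₁, s₂ are made available by enlarging the ambient type
-- to Fin (2 + n); an old element x becomes suc (suc x).
s₁ s₂ : Fin (suc (suc n))
s₁ = zero
s₂ = suc zero

π : Fin n → Subset (suc (suc n)) → Subset n
π s (x₁ ∷ x₂ ∷ X) = if x₁ ∨ x₂ then X ∪ ⁅ s ⁆ else X

private
  ∩-monoˡ-⊆ : {X Y : Subset n} (Z : Subset n) → X ⊆ Y → X ∩ Z ⊆ Y ∩ Z
  ∩-monoˡ-⊆ {X = X} Z X⊆Y x∈ with x∈p∩q⁻ X Z x∈
  ... | x∈X , x∈Z = x∈p∩q⁺ (X⊆Y x∈X , x∈Z)

  ∪-monoˡ-⊆ : {X Y : Subset n} (Z : Subset n) → X ⊆ Y → X ∪ Z ⊆ Y ∪ Z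
  ∪-monoˡ-⊆ {X = X} Z X⊆Y x∈ with x∈p∪q⁻ X Z x∈
  ... | inj₁ x∈X = x∈p∪q⁺ (inj₁ (X⊆Y x∈X))
  ... | inj₂ x∈Z = x∈p∪q⁺ (inj₂ x∈Z)

  π-mono : (s : Fin n) {X Y : Subset (suc (suc n))} → X ⊆ Y → π s X ⊆ π s Y
  π-mono s {x₁ ∷ x₂ ∷ X} {y₁ ∷ y₂ ∷ Y} X⊆Y = go x₁ x₂ y₁ y₂ X⊆Y
    where
    tail⊆ : X ⊆ Y
    tail⊆ = drop-∷-⊆ (drop-∷-⊆ X⊆Y)

    go : ∀ a b c d → (a ∷ b ∷ X) ⊆ (c ∷ d ∷ Y) →
         π s (a ∷ b ∷ X) ⊆ π s (c ∷ d ∷ Y)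
    go false false false false _ = tail⊆
    go false false false true  _ = λ x∈ → x∈p∪q⁺ (inj₁ (tail⊆ x∈))
    go false false true  _     _ = λ x∈ → x∈p∪q⁺ (inj₁ (tail⊆ x∈))
    go false true  false true  _ = ∪-monoˡ-⊆ ⁅ s ⁆ tail⊆
    go false true  true  _     _ = ∪-monoˡ-⊆ ⁅ s ⁆ tail⊆
    go true  _     true  _     _ = ∪-monoˡ-⊆ ⁅ s ⁆ tail⊆
    go true  _     false true  _ = ∪-monoˡ-⊆ ⁅ s ⁆ tail⊆
    go false true  false false h with h (there here)
    ... | there ()
    go true  _     false false h with h here
    ... | ()

  ⊥-independent : (F : IndependenceSystem n) → Independent F ⊥
  ⊥-independent F = down-closed F (⊆-min _) (proj₂ (nonempty F))

parallelExtension : IndependenceSystem n → Fin n → IndependenceSystem (suc (suc n))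
parallelExtension {n} F s = record
  { ground       = ground∘
  ; Independent  = λ X → X ⊆ ground∘ × ∣ X ∩ pair ∣ ≤ 1 × Independent F (π s X)
  ; independent? = λ X →
      (X ⊆? ground∘) ×-dec (∣ X ∩ pair ∣ ≤? 1) ×-dec independent? F (π s X)
  ; ⊆-ground     = proj₁
  ; nonempty     = ⊥ , ⊆-min _ , ∣⊥∩pair∣≤1 , ⊥-independent F
  ; down-closed  = λ X⊆Y (Y⊆ , ≤1 , ind) →
        ⊆-trans X⊆Y Y⊆
      , ≤-trans (p⊆q⇒∣p∣≤∣q∣ (∩-monoˡ-⊆ pair X⊆Y)) ≤1
      , down-closed F (π-mono s X⊆Y) ind
  }
  where
  ground∘ pair : Subset (suc (suc n))
  ground∘ = inside ∷ inside ∷ (ground F - s)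
  pair    = ⁅ s₁ ⁆ ∪ ⁅ s₂ ⁆

  ∣⊥∩pair∣≤1 : ∣ ⊥ ∩ pair ∣ ≤ 1
  ∣⊥∩pair∣≤1 = ≤-trans
    (≤-reflexive (trans (cong ∣_∣ (∩-zeroˡ pair)) (∣⊥∣≡0 (suc (suc n))))) z≤n

restriction : IndependenceSystem n → Subset n → IndependenceSystem n
restriction F Y = record
  { ground       = Y
  ; Independent  = λ X → X ⊆ Y × Independent F X
  ; independent? = λ X → (X ⊆? Y) ×-dec independent? F X
  ; ⊆-ground     = proj₁
  ; nonempty     = ⊥ , ⊆-min _ , ⊥-independent F
  ; down-closed  = λ X⊆Z (Z⊆Y , ind) → ⊆-trans X⊆Z Z⊆Y , down-closed F X⊆Z ind
  }

contraction : (F : IndependenceSystem n) (I : Subset n) → Independent F I →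
              IndependenceSystem n
contraction F I I-ind = record
  { ground       = ground F ─ I
  ; Independent  = λ X → X ⊆ ground F ─ I × Independent F (X ∪ I)
  ; independent? = λ X → (X ⊆? ground F ─ I) ×-dec independent? F (X ∪ I)
  ; ⊆-ground     = proj₁
  ; nonempty     = ⊥ , ⊆-min _ , subst (Independent F) (sym (∪-identityˡ I)) I-ind
  ; down-closed  = λ X⊆Y (Y⊆ , ind) →
      ⊆-trans X⊆Y Y⊆ , down-closed F (∪-monoˡ-⊆ I X⊆Y) ind
  }

{-# OPTIONS --safe #-}
module Submission where

open import Data.Bool using (true; false; _∧_)
open import Data.Bool.Properties using (∨-identityʳ)
open import Data.Fin using (Fin; zero; suc)
open import Data.Fin.Properties using (_≟_)
open import Data.Fin.Subset
open import Data.Fin.Subset.Properties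
open import Data.Nat using (ℕ; suc; _+_; _*_; _≤_; _≤?_; z≤n; s≤s; >-nonZero)
open import Data.Nat.Properties
  using (≤-refl; ≤-trans; ≤-reflexive; ≰⇒>; <-irrefl; m≤n*m; *-comm; *-identityʳ;
         *-monoʳ-≤; +-identityʳ; +-monoˡ-≤; module ≤-Reasoning)
open import Data.Product using (Σ; _×_; _,_; proj₁)
open import Data.Sum using (_⊎_; inj₁; inj₂)
open import Data.Vec using (_∷_; here; there)
open import Function using (_∘_)
open import Relation.Binary.PropositionalEquality
  using (_≡_; _≢_; refl; sym; trans; cong; cong₂; subst; subst₂)
open import Relation.Nullary using (¬_; yes; no; contradiction)
open import Relation.Nullary.Decidable using (_⊎-dec_; ¬?; decidable-stable)
open import Defs

-- A parallel extension is a k-system because π s maps bases of X to bases of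
-- π s X without changing their size.  For contractions, take the ground set
-- {q, e} ∪ P with |P| = k + 1 (q is zero, e is suc zero), where X is independent
-- iff q ∉ X or |X| ≤ 2.  A basis of size at most 1 of a set is the whole set,
-- and no independent set has more than k + 2 ≤ 2k elements, so this is a
-- k-system.  After contracting {e}, the ground set has the bases {q} and P.

private
  variable
    n : ℕ

-- Adding and removing one element of a subset

x∉p-x : (p : Subset n) (x : Fin n) → x ∉ p - x
x∉p-x (_ ∷ p) zero    ()
x∉p-x (_ ∷ p) (suc x) (there x∈) = x∉p-x p x x∈

x∉p⇒∣p∪⁅x⁆∣≡1+∣p∣ : (p : Subset n) (x : Fin n) → x ∉ p → ∣ p ∪ ⁅ x ⁆ ∣ ≡ suc ∣ p ∣
x∉p⇒∣p∪⁅x⁆∣≡1+∣p∣ (true  ∷ p) zero    x∉ = contradiction here x∉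
x∉p⇒∣p∪⁅x⁆∣≡1+∣p∣ (false ∷ p) zero    x∉ = cong (suc ∘ ∣_∣) (∪-identityʳ p)
x∉p⇒∣p∪⁅x⁆∣≡1+∣p∣ (true  ∷ p) (suc x) x∉ =
  cong suc (x∉p⇒∣p∪⁅x⁆∣≡1+∣p∣ p x (x∉ ∘ there))
x∉p⇒∣p∪⁅x⁆∣≡1+∣p∣ (false ∷ p) (suc x) x∉ = x∉p⇒∣p∪⁅x⁆∣≡1+∣p∣ p x (x∉ ∘ there)

p∪⁅x⁆⊆q : {p q : Subset n} {x : Fin n} → p ⊆ q → x ∈ q → p ∪ ⁅ x ⁆ ⊆ q
p∪⁅x⁆⊆q {p = p} {x = x} p⊆q x∈q y∈ with x∈p∪q⁻ p ⁅ x ⁆ y∈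
... | inj₁ y∈p = p⊆q y∈p
... | inj₂ y∈⁅x⁆ rewrite x∈⁅y⁆⇒x≡y x y∈⁅x⁆ = x∈q

x∈p∪⁅x⁆ : (p : Subset n) (x : Fin n) → x ∈ p ∪ ⁅ x ⁆
x∈p∪⁅x⁆ p x = q⊆p∪q p ⁅ x ⁆ (x∈⁅x⁆ x)

-- Bases and one-element additions

module _ (F : IndependenceSystem n) {X B : Subset n} where

  basis-saturated : IsBasis F X B → ∀ {x} → x ∈ X → Independent F (B ∪ ⁅ x ⁆) → x ∈ B
  basis-saturated (_ , B⊆X , max) {x} x∈X ind = decidable-stable (x ∈? B) λ x∉B →
    max (B ∪ ⁅ x ⁆) ind (p∪⁅x⁆⊆q B⊆X x∈X) (p⊆p∪q ⁅ x ⁆ , x , x∈p∪⁅x⁆ B x , x∉B)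

  -- Any independent `C` strictly above `B` contains `B` with one further point, and that smaller
  -- set is independent by down-closure. So maximality need only be tested on one-point additions.
  saturated-basis : Independent F B → B ⊆ X →
                    (∀ {x} → x ∈ X → Independent F (B ∪ ⁅ x ⁆) → x ∈ B) → IsBasis F X B
  saturated-basis ind B⊆X sat = ind , B⊆X , λ C C-ind C⊆X (B⊆C , x , x∈C , x∉B) →
    x∉B (sat (C⊆X x∈C) (down-closed F (p∪⁅x⁆⊆q B⊆C x∈C) C-ind))

-- Parallel extensions

module _ (F : IndependenceSystem n) (s : Fin n) where

  F∘ : IndependenceSystem (suc (suc n))
  F∘ = parallelExtension F s

  -- `a` and `b` record membership of `s₁` and `s₂`, so `a ∧ b ≡ false` expresses that at most one
  -- of the two copies is present.
  independent∘⁺ : ∀ a b {P} → a ∧ b ≡ false → P ⊆ ground F - s →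
                  Independent F (π s (a ∷ b ∷ P)) → Independent F∘ (a ∷ b ∷ P)
  independent∘⁺ a b {P} ab P⊆ ind = ⊆ground∘ , ∣∩pair∣≤1 a b ab , ind
    where
    ⊆ground∘ : a ∷ b ∷ P ⊆ ground F∘
    ⊆ground∘ here               = here
    ⊆ground∘ (there here)       = there here
    ⊆ground∘ (there (there x∈)) = there (there (P⊆ x∈))

    ∣P∩∅∣≡0 : ∣ P ∩ (⊥ ∪ ⊥) ∣ ≡ 0
    ∣P∩∅∣≡0 = trans (cong ∣_∣ (trans (cong (P ∩_) (∪-identityˡ ⊥)) (∩-zeroʳ P)))
                    (∣⊥∣≡0 n)

    ∣∩pair∣≤1 : ∀ a b → a ∧ b ≡ false → ∣ (a ∷ b ∷ P) ∩ (⁅ s₁ ⁆ ∪ ⁅ s₂ ⁆) ∣ ≤ 1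
    ∣∩pair∣≤1 true  false _ rewrite ∣P∩∅∣≡0 = ≤-refl
    ∣∩pair∣≤1 false true  _ rewrite ∣P∩∅∣≡0 = ≤-refl
    ∣∩pair∣≤1 false false _ rewrite ∣P∩∅∣≡0 = z≤n

  independent∘⁻ : ∀ a b {P} → Independent F∘ (a ∷ b ∷ P) →
                  a ∧ b ≡ false × P ⊆ ground F - s
  independent∘⁻ a b {P} (⊆g , ≤1 , _) = exclusive a b ≤1 , drop-∷-⊆ (drop-∷-⊆ ⊆g)
    where
    exclusive : ∀ a b → ∣ (a ∷ b ∷ P) ∩ (⁅ s₁ ⁆ ∪ ⁅ s₂ ⁆) ∣ ≤ 1 → a ∧ b ≡ false
    exclusive true  true  (s≤s ())
    exclusive true  false _ = refl
    exclusive false _     _ = refl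

  ∈-π⁺ : ∀ a b {P x} → x ∈ P → x ∈ π s (a ∷ b ∷ P)
  ∈-π⁺ false false x∈ = x∈
  ∈-π⁺ false true  x∈ = p⊆p∪q ⁅ s ⁆ x∈
  ∈-π⁺ true  _     x∈ = p⊆p∪q ⁅ s ⁆ x∈

  ∈-π⁻ : ∀ a b {P x} → x ≢ s → x ∈ π s (a ∷ b ∷ P) → x ∈ P
  ∈-π⁻ a b {P} {x} x≢s = go a b
    where
    old : x ∈ P ∪ ⁅ s ⁆ → x ∈ P
    old x∈ with x∈p∪q⁻ P ⁅ s ⁆ x∈
    ... | inj₁ x∈P = x∈P
    ... | inj₂ x∈s = contradiction (x∈⁅y⁆⇒x≡y s x∈s) x≢s

    go : ∀ a b → x ∈ π s (a ∷ b ∷ P) → x ∈ P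
    go false false = λ x∈ → x∈
    go false true  = old
    go true  _     = old

  π⊆ : ∀ X {Y} → (∀ {x} → suc (suc x) ∈ X → x ∈ Y) → (s₁ ∈ X ⊎ s₂ ∈ X → s ∈ Y) → π s X ⊆ Y
  π⊆ (false ∷ false ∷ X) old new x∈ = old (there (there x∈))
  π⊆ (false ∷ true  ∷ X) old new = p∪⁅x⁆⊆q (old ∘ there ∘ there) (new (inj₂ (there here)))
  π⊆ (true  ∷ _     ∷ X) old new = p∪⁅x⁆⊆q (old ∘ there ∘ there) (new (inj₁ here))

  s∈π⁺ : ∀ X → s₁ ∈ X ⊎ s₂ ∈ X → s ∈ π s X
  s∈π⁺ (true  ∷ _    ∷ X) _ = x∈p∪⁅x⁆ X s
  s∈π⁺ (false ∷ true ∷ X) _ = x∈p∪⁅x⁆ X s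
  s∈π⁺ (false ∷ false ∷ X) (inj₁ ())
  s∈π⁺ (false ∷ false ∷ X) (inj₂ (there ()))

  -- An independent set contains at most one copy, and `π s` trades it for `s`. No element is merged
  -- with another, because `s` has been removed from the old part of the ground set.
  ∣π∣ : ∀ P → Independent F∘ P → ∣ π s P ∣ ≡ ∣ P ∣
  ∣π∣ (a ∷ b ∷ P) ind with independent∘⁻ a b ind
  ... | ab , P⊆ = go a b ab
    where
    go : ∀ a b → a ∧ b ≡ false → ∣ π s (a ∷ b ∷ P) ∣ ≡ ∣ a ∷ b ∷ P ∣
    go false false _ = refl
    go false true  _ = x∉p⇒∣p∪⁅x⁆∣≡1+∣p∣ P s (x∉p-x (ground F) s ∘ P⊆)
    go true  false _ = x∉p⇒∣p∪⁅x⁆∣≡1+∣p∣ P s (x∉p-x (ground F) s ∘ P⊆)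

  -- A point that could be added to `π s P` lifts to a point that could be added to the basis `P`:
  -- an old element to itself, and `s` to a copy that lies in `X`.
  π-basis : ∀ X P → X ⊆ ground F∘ → IsBasis F∘ X P → IsBasis F (π s X) (π s P)
  π-basis (c ∷ d ∷ X) (a ∷ b ∷ P) X⊆ basis@(ind@(_ , _ , πP-ind) , P⊆X , _)
    with independent∘⁻ a b ind
  ... | ab , P⊆g = saturated-basis F πP-ind
    (π⊆ (a ∷ b ∷ P) (∈-π⁺ c d ∘ drop-there ∘ drop-there ∘ P⊆X) (s∈π⁺ (c ∷ d ∷ X) ∘ new))
    sat
    where
    new : s₁ ∈ a ∷ b ∷ P ⊎ s₂ ∈ a ∷ b ∷ P → s₁ ∈ c ∷ d ∷ X ⊎ s₂ ∈ c ∷ d ∷ X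
    new (inj₁ s₁∈) = inj₁ (P⊆X s₁∈)
    new (inj₂ s₂∈) = inj₂ (P⊆X s₂∈)

    X⊆g : X ⊆ ground F - s
    X⊆g = drop-∷-⊆ (drop-∷-⊆ X⊆)

    sat-s : ∀ a b c d → IsBasis F∘ (c ∷ d ∷ X) (a ∷ b ∷ P) → s ∈ π s (c ∷ d ∷ X) →
            Independent F (π s (a ∷ b ∷ P) ∪ ⁅ s ⁆) → s ∈ π s (a ∷ b ∷ P)
    sat-s true  _     _     _     _     _  _ = x∈p∪⁅x⁆ P s
    sat-s false true  _     _     _     _  _ = x∈p∪⁅x⁆ P s
    -- With no copy in `X`, the point `s` would have to be an old element of `X`.
    sat-s false false false false _     s∈ _ = contradiction (X⊆g s∈) (x∉p-x (ground F) s)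
    -- The copy `s₁` is available in `X` and can be added to the basis, so saturation would put it
    -- there, against its first bit. The next clause does the same with `s₂`.
    sat-s false false true  _     basis _  i
      with basis-saturated F∘ basis {s₁} here
             (independent∘⁺ true false refl (P⊆g ∘ subst (_ ∈_) (∪-identityʳ P))
               (subst (λ Z → Independent F (Z ∪ ⁅ s ⁆)) (sym (∪-identityʳ P)) i))
    ... | ()
    sat-s false false false true  basis _  i
      with basis-saturated F∘ basis {s₂} (there here)
             (independent∘⁺ false true refl (P⊆g ∘ subst (_ ∈_) (∪-identityʳ P))
               (subst (λ Z → Independent F (Z ∪ ⁅ s ⁆)) (sym (∪-identityʳ P)) i))
    ... | there ()

    sat-old : ∀ {x} → IsBasis F∘ (c ∷ d ∷ X) (a ∷ b ∷ P) → x ∈ X →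
              Independent F (π s (a ∷ b ∷ P) ∪ ⁅ x ⁆) → x ∈ P
    sat-old {x} basis x∈X i = drop-there (drop-there
      (basis-saturated F∘ basis (there (there x∈X))
        (subst (Independent F∘) a∷b∷P∪x≡ (independent∘⁺ a b ab
          (p∪⁅x⁆⊆q P⊆g (X⊆g x∈X))
          -- The image of the enlarged set lies inside `π s (a ∷ b ∷ P) ∪ ⁅ x ⁆`, so it inherits
          -- independence from `i`.
          (down-closed F (π⊆ (a ∷ b ∷ P ∪ ⁅ x ⁆)
            (p∪⁅x⁆⊆q (p⊆p∪q ⁅ x ⁆ ∘ ∈-π⁺ a b) (x∈p∪⁅x⁆ _ x) ∘ drop-there ∘ drop-there)
            (p⊆p∪q ⁅ x ⁆ ∘ s∈π⁺ (a ∷ b ∷ P) ∘ λ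
              { (inj₁ here) → inj₁ here ; (inj₂ (there here)) → inj₂ (there here) })) i)))))
      where
      a∷b∷P∪x≡ : a ∷ b ∷ (P ∪ ⁅ x ⁆) ≡ (a ∷ b ∷ P) ∪ ⁅ suc (suc x) ⁆
      a∷b∷P∪x≡ = sym (cong₂ (λ a b → a ∷ b ∷ P ∪ ⁅ x ⁆) (∨-identityʳ a) (∨-identityʳ b))

    sat : ∀ {x} → x ∈ π s (c ∷ d ∷ X) → Independent F (π s (a ∷ b ∷ P) ∪ ⁅ x ⁆) →
          x ∈ π s (a ∷ b ∷ P)
    sat {x} x∈ i with x ≟ s
    ... | yes refl = sat-s a b c d basis x∈ i
    ... | no  x≢s  = ∈-π⁺ a b (sat-old basis (∈-π⁻ c d x≢s x∈) i)

  parallelExtension-isKSystem : ∀ k → s ∈ ground F → IsKSystem k F → IsKSystem k F∘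
  parallelExtension-isKSystem k s∈g kF X X⊆ P Q P-basis Q-basis =
    subst₂ (λ p q → p ≤ k * q) (∣π∣ P (proj₁ P-basis)) (∣π∣ Q (proj₁ Q-basis))
      -- If `X` contains a copy, then `s` enters `π s X`; `s∈g` keeps this set inside the ground set
      -- of `F`.
      (kF (π s X) (π⊆ X (p─q⊆p (ground F) ⁅ s ⁆ ∘ drop-there ∘ drop-there ∘ X⊆) (λ _ → s∈g))
        (π s P) (π s Q) (π-basis X P X⊆ P-basis) (π-basis X Q X⊆ Q-basis))

-- Restrictions

restriction-isKSystem : ∀ k (F : IndependenceSystem n) Y → Y ⊆ ground F →
                        IsKSystem k F → IsKSystem k (restriction F Y)
restriction-isKSystem k F Y Y⊆ kF X X⊆Y P Q P-basis Q-basis =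
  kF X (Y⊆ ∘ X⊆Y) P Q (basis P-basis) (basis Q-basis)
  where
  basis : ∀ {B} → IsBasis (restriction F Y) X B → IsBasis F X B
  basis ((_ , ind) , B⊆X , max) =
    -- Every competitor `C` inside `X` already lies in `Y`, so both systems test maximality against
    -- the same sets.
    ind , B⊆X , λ C C-ind C⊆X → max C ((X⊆Y ∘ C⊆X) , C-ind) C⊆X

-- A contraction that is not a `k`-system

starSystem : ∀ n → IndependenceSystem (suc n)
starSystem n = record
  { ground       = ⊤
  ; Independent  = λ X → zero ∉ X ⊎ ∣ X ∣ ≤ 2
  ; independent? = λ X → ¬? (zero ∈? X) ⊎-dec (∣ X ∣ ≤? 2)
  ; ⊆-ground     = λ _ → ⊆-max _
  ; nonempty     = ⊥ , inj₁ ∉⊥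
  ; down-closed  = λ
      { X⊆Y (inj₁ q∉Y) → inj₁ (q∉Y ∘ X⊆Y)
      ; X⊆Y (inj₂ ∣Y∣≤2) → inj₂ (≤-trans (p⊆q⇒∣p∣≤∣q∣ X⊆Y) ∣Y∣≤2) }
  }

starSystem-isKSystem : ∀ k → 2 ≤ k → IsKSystem k (starSystem (2 + k))
starSystem-isKSystem k 2≤k X _ P Q (P-ind , P⊆X , _) Q-basis with ∣ Q ∣ ≤? 1
... | yes ∣Q∣≤1 = ≤-trans (p⊆q⇒∣p∣≤∣q∣ (X⊆Q ∘ P⊆X)) (m≤n*m ∣ Q ∣ k)
  where
  instance _ = >-nonZero (≤-trans (s≤s z≤n) 2≤k)

  X⊆Q : X ⊆ Q
  -- Adding a point to `Q` gives at most two elements, and every set that small is independent.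
  X⊆Q {x} x∈X = decidable-stable (x ∈? Q) λ x∉Q →
    x∉Q (basis-saturated (starSystem _) Q-basis x∈X
      (inj₂ (subst (_≤ 2) (sym (x∉p⇒∣p∪⁅x⁆∣≡1+∣p∣ Q x x∉Q)) (s≤s ∣Q∣≤1))))
... | no ∣Q∣≰1 = begin
  ∣ P ∣      ≤⟨ ∣P∣≤2+k P P-ind ⟩
  2 + k      ≤⟨ +-monoˡ-≤ k 2≤k ⟩
  k + k      ≡⟨ cong (k +_) (+-identityʳ k) ⟨
  2 * k      ≡⟨ *-comm 2 k ⟩
  k * 2      ≤⟨ *-monoʳ-≤ k (≰⇒> ∣Q∣≰1) ⟩
  k * ∣ Q ∣  ∎
  where
  open ≤-Reasoning

  ∣P∣≤2+k : ∀ P → Independent (starSystem (2 + k)) P → ∣ P ∣ ≤ 2 + k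
  ∣P∣≤2+k P           (inj₂ ∣P∣≤2) = ≤-trans ∣P∣≤2 (s≤s (s≤s z≤n))
  ∣P∣≤2+k (true  ∷ P) (inj₁ q∉P)   = contradiction here q∉P
  -- Without q only `2 + k` points remain.
  ∣P∣≤2+k (false ∷ P) (inj₁ _)     = ∣p∣≤n P

-- The contracted ground set has bases of sizes `1 + k` and 1, while `1 + k ≤ k * 1` is false.
starSystem/e-¬isKSystem : ∀ k I-ind →
  ¬ IsKSystem k (contraction (starSystem (2 + k)) ⁅ suc zero ⁆ I-ind)
starSystem/e-¬isKSystem k I-ind kF/e =
  <-irrefl refl (subst₂ _≤_ ∣P∣≡1+k k*∣Q∣≡k (kF/e (⊤ ─ ⁅ e ⁆) ⊆-refl P Q P-basis Q-basis))
  where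
  e : Fin (3 + k)
  e = suc zero

  F/e : IndependenceSystem (3 + k)
  F/e = contraction (starSystem (2 + k)) ⁅ e ⁆ I-ind

  P Q : Subset (3 + k)
  P = outside ∷ outside ∷ ⊤
  Q = ⁅ zero ⁆

  ∣P∣≡1+k : ∣ P ∣ ≡ suc k
  ∣P∣≡1+k = ∣⊤∣≡n (suc k)

  k*∣Q∣≡k : k * ∣ Q ∣ ≡ k
  k*∣Q∣≡k = trans (cong (k *_) (∣⁅x⁆∣≡1 (zero {2 + k}))) (*-identityʳ k)

  P⊆ : P ⊆ ⊤ ─ ⁅ e ⁆
  P⊆ = out⊆ (out⊆ (⊆-reflexive (sym (p─⊥≡p ⊤))))

  P-saturated : ∀ {x} → x ∈ ⊤ ─ ⁅ e ⁆ → Independent F/e (P ∪ ⁅ x ⁆) → x ∈ P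
  P-saturated here (_ , inj₁ q∉) = contradiction here q∉
  -- Contraction tests `P` together with q and e, which has `3 + k` elements.
  P-saturated here (_ , inj₂ ≤2)
    with subst (λ Z → 2 + ∣ Z ∣ ≤ 2) (trans (∪-identityʳ (⊤ {1 + k} ∪ ⊥)) (∪-identityʳ ⊤)) ≤2
  ... | s≤s (s≤s ())
  P-saturated (there (there _)) _ = there (there ∈⊤)

  P-basis : IsBasis F/e (⊤ ─ ⁅ e ⁆) P
  -- `P` together with e avoids q, hence is independent whatever its size.
  P-basis = saturated-basis F/e (P⊆ , inj₁ λ ()) P⊆ P-saturated

  Q⊆ : Q ⊆ ⊤ ─ ⁅ e ⁆
  Q⊆ = in⊆in (⊆-min _)

  ∣Q∪e∣≤2 : ∣ Q ∪ ⁅ e ⁆ ∣ ≤ 2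
  ∣Q∪e∣≤2 = ≤-reflexive (cong (2 +_) (trans (cong ∣_∣ (∪-identityʳ (⊥ {1 + k}))) (∣⊥∣≡0 (1 + k))))

  Q-saturated : ∀ {x} → x ∈ ⊤ ─ ⁅ e ⁆ → Independent F/e (Q ∪ ⁅ x ⁆) → x ∈ Q
  Q-saturated here _ = here
  Q-saturated (there (there _)) (_ , inj₁ q∉) = contradiction here q∉
  -- Together with e, the set consists of q, e and a further point, so its size is 3.
  Q-saturated (there (there {i = y} _)) (_ , inj₂ ≤2)
    with subst (λ m → 2 + m ≤ 2)
           (trans (cong ∣_∣ (trans (∪-identityʳ (⊥ ∪ ⁅ y ⁆)) (∪-identityˡ ⁅ y ⁆))) (∣⁅x⁆∣≡1 y)) ≤2
  ... | s≤s (s≤s ())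

  Q-basis : IsBasis F/e (⊤ ─ ⁅ e ⁆) Q
  Q-basis = saturated-basis F/e (Q⊆ , inj₂ ∣Q∪e∣≤2) Q⊆ Q-saturated

lemma10 : (∀ (k : ℕ) → 1 ≤ k → ∀ (n : ℕ) (F : IndependenceSystem n) → IsKSystem k F →
    (∀ (s : Fin n) → s ∈ ground F → ¬ Loop F s → IsKSystem k (parallelExtension F s))
    × (∀ (Y : Subset n) → Y ⊆ ground F → IsKSystem k (restriction F Y)))
    × (∀ (k : ℕ) → 2 ≤ k →
    Σ ℕ λ n → Σ (IndependenceSystem n) λ F → Σ (Subset n) λ I → Σ (Independent F I) λ I-ind →
    IsKSystem k F × ¬ IsKSystem k (contraction F I I-ind))
lemma10 =
    (λ k _ n F kF →
        (λ s s∈g _ → parallelExtension-isKSystem F s k s∈g kF)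
      , (λ Y Y⊆ → restriction-isKSystem k F Y Y⊆ kF))
  , (λ k 2≤k →
      -- The points are q, e and the `k + 1` elements of P; the contracted set, containing only e,
      -- is independent because it avoids q.
      3 + k , starSystem (2 + k) , ⁅ suc zero ⁆ , inj₁ (λ ()) ,
      starSystem-isKSystem k 2≤k , starSystem/e-¬isKSystem k (inj₁ λ ()))
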